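{- $R_{\mathrm{vm}}(4)=11$.
   Context: All graphs are finite and simple. For a vertex $v$ of $G$, the local complementation $G*v$ is obtained from $G$ by complementing the induced subgraph on the neighborhood $N_G(v)$, all other edges unchanged. The LC orbit $[G]_{\mathrm{LC}}$ is the set of graphs obtained from $G$ by finite sequences of local complementations. A graph $H$ is a vertex-minor of $G$ if $H$ is isomorphic to an induced subgraph of some graph in $[G]_{\mathrm{LC}}$. $E_k$ denotes the edgeless graph on $k$ vertices. The vertex-minor Ramsey number $R_{\mathrm{vm}}(k)$ is the smallest integer $n$ such that every graph on $n$ vertices contains $E_k$ as a vertex-minor. -}

module Defs where

open import Data.Nat using (ℕ; _<_)
open import Data.Fin using (Fin; _≟_)
open import Data.Bool using (Bool; true; false; not; _∧_; _xor_; if_then_else_)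
open import Data.Product using (Σ; _×_; ∃; ∃-syntax)
open import Relation.Nullary using (¬_; does)
open import Relation.Binary.PropositionalEquality using (_≡_)
open import Function.Definitions using (Injective)

Adj : ℕ → Set
Adj n = Fin n → Fin n → Bool

IsSimple : ∀ {n} → Adj n → Set
IsSimple {n} G = (∀ (x y : Fin n) → G x y ≡ G y x) × (∀ (x : Fin n) → G x x ≡ false)

lc : ∀ {n} → Adj n → Fin n → Adj n
lc G v x y = if does (x ≟ y) then G x y else (G x y xor (G v x ∧ G v y))

data LCReach {n} (G : Adj n) : Adj n → Set where
  here : LCReach G G
  step : ∀ {H} → LCReach G H → (v : Fin n) → LCReach G (lc H v)

-- E_k is a vertex-minor of G: some H in the LC orbit of G has an induced
-- subgraph isomorphic to E_k, i.e. k distinct vertices pairwise non-adjacent in H.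
HasEdgelessVM : ∀ {n} → ℕ → Adj n → Set
HasEdgelessVM {n} k G =
  Σ (Adj n) λ H → LCReach G H ×
    (Σ (Fin k → Fin n) λ f → Injective _≡_ _≡_ f × (∀ (i j : Fin k) → H (f i) (f j) ≡ false))

AllContainEk : ℕ → ℕ → Set
AllContainEk k n = ∀ (G : Adj n) → IsSimple G → HasEdgelessVM k G

RvmIs : ℕ → ℕ → Set
RvmIs k r = AllContainEk k r × (∀ (m : ℕ) → m < r → ¬ AllContainEk k m)

{-# OPTIONS --safe #-}

-- Write R ≼ G when R is isomorphic to an induced subgraph of a graph in the LC orbit of G.
--
-- Upper bound.  Up to local equivalence and isomorphism there are very few graphs without E₄ as
-- a vertex-minor: 1, 1, 2, 3, 5, 6, 9, 8, 10, 2, 1, 0 of them on 0, 1, …, 11 vertices.  If R ≼ G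
-- and G has more vertices than R, then some one-vertex extension of R is ≼ G.  So it suffices to
-- exhibit, for each listed R and each neighbourhood of a new vertex, a sequence of local
-- complementations that leads either to a graph with an independent 4-set or to a graph of the
-- next list.
--
-- Lower bound.  The LC orbit of the unique exceptional graph on 10 vertices has only six members
-- up to isomorphism, and none of them has an independent 4-set.
module Submission where

open import Defs
open import Data.Bool using (Bool; true; false; T; T?; not; _∧_; _∨_; _xor_; if_then_else_)
import Data.Bool.Properties as Bool
open import Data.Bool.ListAction using (any; all)
open import Data.Fin using (Fin; zero; suc; _≟_; inject≤; fromℕ<; toℕ)
open import Data.Fin.Patterns using (0F; 1F; 2F; 3F)
open import Data.Fin.Properties
  using (all?; any?; suc-injective; inject≤-injective; injective⇒≤; ¬∀⟶∃¬; toℕ-fromℕ<)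
open import Data.List using (List; []; _∷_; foldl; map)
open import Data.List.Relation.Unary.All as All using (All)
open import Data.List.Relation.Unary.All.Properties using (all⁺)
open import Data.List.Relation.Unary.Any as Any using (Any; here; there; satisfied)
open import Data.List.Relation.Unary.Any.Properties using (any⁻)
open import Data.Digit using (toNatDigits)
open import Data.Nat using (ℕ; zero; suc; _≡ᵇ_; _/_; _%_; _≤_; _<_; s≤s⁻¹)
import Data.Nat.Properties as ℕ
open import Data.Product using (Σ; ∃; _×_; _,_; proj₁; proj₂)
open import Data.Sum using (_⊎_; inj₁; inj₂)
open import Data.Vec using (Vec; []; _∷_; lookup; replicate; tabulate; zipWith)
import Data.Vec as Vec
open import Data.Vec.Properties using (lookup-zipWith; lookup-map; lookup∘tabulate)
open import Function using (_∘_; id; Equivalence)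
open import Function.Definitions using (Injective)
open import Relation.Binary.PropositionalEquality
open import Relation.Nullary using (¬_; Dec; does; yes; no; contradiction; ¬?; _×-dec_; _→-dec_)
open import Relation.Nullary.Decidable using (toWitness)

private variable
  k l m n N : ℕ

-- Vertex-minors

infix 4 _≼_

_≼_ : Adj m → Adj n → Set
_≼_ {m} {n} R G =
  Σ (Adj n) λ H → LCReach G H ×
    (Σ (Fin m → Fin n) λ f → Injective _≡_ _≡_ f × (∀ i j → H (f i) (f j) ≡ R i j))

-- With this as the left-hand graph, `edgeless k ≼ G` unfolds to `HasEdgelessVM k G`, so the two are
-- interchanged without conversion.
edgeless : ∀ k → Adj k
edgeless _ _ _ = false

LCReach-trans : {G H K : Adj n} → LCReach G H → LCReach H K → LCReach G K
LCReach-trans p here       = p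
LCReach-trans p (step q v) = step (LCReach-trans p q) v

-- The new adjacency of two vertices depends only on the old adjacencies among them and `v`, so
-- local complementation commutes with restriction to an induced subgraph containing `v`.
-- Injectivity makes the two equality tests agree.
lc-restrict : {H : Adj n} {R : Adj m} {f : Fin m → Fin n} → Injective _≡_ _≡_ f →
  (∀ i j → H (f i) (f j) ≡ R i j) → ∀ v i j → lc H (f v) (f i) (f j) ≡ lc R v i j
lc-restrict {f = f} inj eq v i j with f i ≟ f j | i ≟ j
... | yes _     | yes _   = eq i j
... | yes fi≡fj | no i≢j  = contradiction (inj fi≡fj) i≢j
... | no fi≢fj  | yes i≡j = contradiction (cong f i≡j) fi≢fj
... | no _      | no _    = cong₂ _xor_ (eq i j) (cong₂ _∧_ (eq v i) (eq v j))

-- The same sequence is replayed in the larger graph at the images under `f`; the embedding itself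
-- never changes.
LCReach-lift : {H : Adj n} {R S : Adj m} {f : Fin m → Fin n} → Injective _≡_ _≡_ f →
  (∀ i j → H (f i) (f j) ≡ R i j) → LCReach R S →
  ∃ λ K → LCReach H K × (∀ i j → K (f i) (f j) ≡ S i j)
LCReach-lift inj eq here = _ , here , eq
LCReach-lift {f = f} inj eq (step {S} p v) with LCReach-lift inj eq p
... | K , q , eq′ = _ , step {H = K} q (f v) , lc-restrict {H = K} {R = S} inj eq′ v

≼-trans : {Q : Adj l} {R : Adj m} {G : Adj n} → Q ≼ R → R ≼ G → Q ≼ G
≼-trans (_ , p , f , f-inj , f-eq) (_ , q , g , g-inj , g-eq) with LCReach-lift g-inj g-eq p
... | _ , q′ , eq = _ , LCReach-trans q q′ , g ∘ f , f-inj ∘ g-inj ,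
  λ i j → trans (eq (f i) (f j)) (f-eq i j)

lc-simple : {G : Adj n} → IsSimple G → ∀ v → IsSimple (lc G v)
lc-simple {G = G} (sym-G , irr-G) v = sym-lc , irr-lc
  where
  sym-lc : ∀ x y → lc G v x y ≡ lc G v y x
  sym-lc x y with x ≟ y | y ≟ x
  ... | yes _   | yes _   = sym-G x y
  ... | yes x≡y | no y≢x  = contradiction (sym x≡y) y≢x
  ... | no x≢y  | yes y≡x = contradiction (sym y≡x) x≢y
  ... | no _    | no _    = cong₂ _xor_ (sym-G x y) (Bool.∧-comm (G v x) (G v y))

  irr-lc : ∀ x → lc G v x x ≡ false
  irr-lc x with x ≟ x
  ... | yes _  = irr-G x
  ... | no x≢x = contradiction refl x≢x

LCReach-simple : {G H : Adj n} → IsSimple G → LCReach G H → IsSimple H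
LCReach-simple s here       = s
LCReach-simple s (step p v) = lc-simple (LCReach-simple s p) v

vertexOutside : {f : Fin n → Fin N} → Injective _≡_ _≡_ f → n < N → ∃ λ z → ∀ i → f i ≢ z
vertexOutside {N = N} {f} inj n<N with all? (λ z → any? (λ i → f i ≟ z))
-- Choosing preimages under a surjection would inject `Fin N` into `Fin n`.
... | yes surj = contradiction (injective⇒≤ section-injective) (ℕ.<⇒≱ n<N)
  where
  section-injective : Injective _≡_ _≡_ (proj₁ ∘ surj)
  section-injective {x} {y} eq = trans (sym (proj₂ (surj x))) (trans (cong f eq) (proj₂ (surj y)))
... | no ¬surj with ¬∀⟶∃¬ N _ (λ z → any? λ i → f i ≟ z) ¬surj
...   | z , z∉f = z , λ i fi≡z → z∉f (i , fi≡z)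

-- Concrete graphs

-- The head of r ∷ g is vertex 0, and r holds its adjacencies to the vertices of g.
data Graph : ℕ → Set where
  []  : Graph zero
  _∷_ : Vec Bool n → Graph n → Graph (suc n)

adj : Graph n → Adj n
adj (r ∷ g) zero    zero    = false
adj (r ∷ g) zero    (suc j) = lookup r j
adj (r ∷ g) (suc i) zero    = lookup r i
adj (r ∷ g) (suc i) (suc j) = adj g i j

adj-sym : (g : Graph n) → ∀ i j → adj g i j ≡ adj g j i
adj-sym (r ∷ g) zero    zero    = refl
adj-sym (r ∷ g) zero    (suc j) = refl
adj-sym (r ∷ g) (suc i) zero    = refl
adj-sym (r ∷ g) (suc i) (suc j) = adj-sym g i j

adj-irrefl : (g : Graph n) → ∀ i → adj g i i ≡ false
adj-irrefl (r ∷ g) zero    = refl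
adj-irrefl (r ∷ g) (suc i) = adj-irrefl g i

adj-simple : (g : Graph n) → IsSimple (adj g)
adj-simple g = adj-sym g , adj-irrefl g

-- The graph `H` containing the copy of `r` has a vertex outside that copy, and `x` records its
-- adjacencies to the copy. Local complementation keeps `H` simple, which settles the diagonal and
-- the symmetric entries.
extension : (r : Graph n) {G : Adj N} → IsSimple G → n < N → adj r ≼ G →
  ∃ λ x → adj (x ∷ r) ≼ G
extension {n} r simple n<N (H , p , f , inj , eq) with vertexOutside inj n<N
... | z , z∉f = x , H , p , f′ , inj′ , eq′
  where
  x : Vec Bool n
  x = tabulate (λ i → H z (f i))

  f′ : Fin (suc n) → _
  f′ zero    = z
  f′ (suc i) = f i

  inj′ : Injective _≡_ _≡_ f′
  inj′ {zero}  {zero}  _  = refl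
  inj′ {zero}  {suc j} eq = contradiction (sym eq) (z∉f j)
  inj′ {suc i} {zero}  eq = contradiction eq (z∉f i)
  inj′ {suc i} {suc j} eq = cong suc (inj eq)

  H-simple : IsSimple H
  H-simple = LCReach-simple simple p

  eq′ : ∀ i j → H (f′ i) (f′ j) ≡ adj (x ∷ r) i j
  eq′ zero    zero    = proj₂ H-simple z
  eq′ zero    (suc j) = sym (lookup∘tabulate _ j)
  eq′ (suc i) zero    = trans (proj₁ H-simple (f i) z) (sym (lookup∘tabulate _ i))
  eq′ (suc i) (suc j) = eq i j

infix 6 _==_

_==_ : Bool → Bool → Bool
true  == b = b
false == b = not b

==-sound : ∀ a b → T (a == b) → b ≡ a
==-sound true  true  _ = refl
==-sound false false _ = refl

-- For `true` this is the neighbourhood of `v`, for `false` the set of its non-neighbours. The entry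
-- at `v` is `false` either way, so that membership also certifies distinctness from `v`.
link : Bool → Graph n → Fin n → Vec Bool n
link b (r ∷ g) zero    = false ∷ Vec.map (b ==_) r
link b (r ∷ g) (suc v) = b == lookup r v ∷ link b g v

link-sound : ∀ b (g : Graph n) v w → T (lookup (link b g v) w) → v ≢ w × adj g v w ≡ b
link-sound b (r ∷ g) zero    (suc w) t =
  (λ ()) , ==-sound b (lookup r w) (subst T (lookup-map w (b ==_) r) t)
link-sound b (r ∷ g) (suc v) zero    t = (λ ()) , ==-sound b (lookup r v) t
link-sound b (r ∷ g) (suc v) (suc w) t with link-sound b g v w t
... | v≢w , eq = v≢w ∘ suc-injective , eq

lookup-link-true : (g : Graph n) → ∀ v w → lookup (link true g v) w ≡ adj g v w
lookup-link-true (r ∷ g) zero    zero    = refl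
lookup-link-true (r ∷ g) zero    (suc w) = lookup-map w (true ==_) r
lookup-link-true (r ∷ g) (suc v) zero    = refl
lookup-link-true (r ∷ g) (suc v) (suc w) = lookup-link-true g v w

-- Each pair of vertices is stored once, in the row of the earlier one, so one pass toggles each
-- pair inside the set exactly once and creates no loops.
complementWithin : Vec Bool n → Graph n → Graph n
complementWithin []      []      = []
complementWithin (b ∷ s) (r ∷ g) =
  (if b then zipWith _xor_ r s else r) ∷ complementWithin s g

lookup-toggle : ∀ b (r s : Vec Bool n) j →
  lookup (if b then zipWith _xor_ r s else r) j ≡ lookup r j xor (b ∧ lookup s j)
lookup-toggle true  r s j = lookup-zipWith _xor_ j r s
lookup-toggle false r s j = sym (Bool.xor-identityʳ (lookup r j))

adj-complementWithin : ∀ (s : Vec Bool n) g x y → adj (complementWithin s g) x y ≡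
  (if does (x ≟ y) then adj g x y else (adj g x y xor (lookup s x ∧ lookup s y)))
adj-complementWithin (b ∷ s) (r ∷ g) zero    zero    = refl
adj-complementWithin (b ∷ s) (r ∷ g) zero    (suc y) = lookup-toggle b r s y
adj-complementWithin (b ∷ s) (r ∷ g) (suc x) zero    = trans (lookup-toggle b r s x)
  (cong (lookup r x xor_) (Bool.∧-comm b (lookup s x)))
adj-complementWithin (b ∷ s) (r ∷ g) (suc x) (suc y) = adj-complementWithin s g x y

localComplement : Graph n → Fin n → Graph n
localComplement g v = complementWithin (link true g v) g

adj-localComplement : ∀ (g : Graph n) v x y → adj (localComplement g v) x y ≡ lc (adj g) v x y
adj-localComplement g v x y = trans (adj-complementWithin (link true g v) g x y)
  (cong₂ (λ a b → if does (x ≟ y) then adj g x y else (adj g x y xor (a ∧ b)))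
    (lookup-link-true g v x) (lookup-link-true g v y))

localComplement-≼ : ∀ (g : Graph n) v → adj (localComplement g v) ≼ adj g
localComplement-≼ g v =
  lc (adj g) v , step here v , id , id , λ x y → sym (adj-localComplement g v x y)

≼-refl : {G : Adj n} → G ≼ G
≼-refl = _ , here , id , id , λ _ _ → refl

-- Saturating, so that every number denotes a vertex.
vertex : ℕ → Fin (suc n)
vertex {zero}  _       = zero
vertex {suc n} zero    = zero
vertex {suc n} (suc d) = suc (vertex d)

-- A sequence of local complementations is encoded as a hexadecimal numeral, read from the left;
-- the digit d + 1 stands for the vertex d, and the digit 0 for no operation.
act : Graph (suc n) → ℕ → Graph (suc n)
act g zero    = g
act g (suc d) = localComplement g (vertex d)

run : ℕ → Graph (suc n) → Graph (suc n)
run w g = foldl act g (toNatDigits 16 w)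

foldl-act-≼ : ∀ (g : Graph (suc n)) ds → adj (foldl act g ds) ≼ adj g
foldl-act-≼ g []           = ≼-refl
foldl-act-≼ g (zero ∷ ds)  = foldl-act-≼ g ds
foldl-act-≼ g (suc d ∷ ds) =
  ≼-trans (foldl-act-≼ (localComplement g (vertex d)) ds) (localComplement-≼ g (vertex d))

run-≼ : ∀ w (g : Graph (suc n)) → adj (run w g) ≼ adj g
run-≼ w g = foldl-act-≼ g (toNatDigits 16 w)

-- Searching for induced subgraphs

_∩_ : Vec Bool n → Vec Bool n → Vec Bool n
_∩_ = zipWith _∧_

∩-sound : ∀ (s t : Vec Bool n) v → T (lookup (s ∩ t) v) → T (lookup s v) × T (lookup t v)
∩-sound s t v p = Equivalence.to Bool.T-∧ (subst T (lookup-zipWith _∧_ v s t) p)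

-- The set marks the vertices still eligible. Vertex 0 is either taken, which removes its neighbours
-- from the set, or skipped.
hasCoclique : ℕ → Vec Bool n → Graph n → Bool
hasCoclique zero    _       _       = true
hasCoclique (suc k) []      []      = false
hasCoclique (suc k) (b ∷ s) (r ∷ g) =
  (b ∧ hasCoclique k (s ∩ Vec.map not r) g) ∨ hasCoclique (suc k) s g

-- Membership in `s` is carried through the induction because it is what yields non-adjacency to the
-- vertices taken earlier.
hasCoclique-sound : ∀ k (s : Vec Bool n) g → T (hasCoclique k s g) →
  Σ (Fin k → Fin n) λ f → Injective _≡_ _≡_ f × (∀ i j → adj g (f i) (f j) ≡ false) ×
    (∀ i → T (lookup s (f i)))
hasCoclique-sound zero s g _ = (λ ()) , (λ {}) , (λ ()) , (λ ())
hasCoclique-sound (suc k) []      []      ()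
hasCoclique-sound {suc n} (suc k) (b ∷ s) (r ∷ g) t
  with Equivalence.to (Bool.T-∨ {b ∧ hasCoclique k (s ∩ Vec.map not r) g}) t
... | inj₂ t′ with hasCoclique-sound (suc k) s g t′
...   | f , inj , coclique , within = suc ∘ f , inj ∘ suc-injective , coclique , within
hasCoclique-sound {suc n} (suc k) (b ∷ s) (r ∷ g) t | inj₁ t′
  with Equivalence.to (Bool.T-∧ {b}) t′
... | tb , t″ with hasCoclique-sound k (s ∩ Vec.map not r) g t″
...   | f , inj , coclique , within = f′ , inj′ , coclique′ , within′
  where
  f′ : Fin (suc k) → Fin (suc n)
  f′ zero    = zero
  f′ (suc i) = suc (f i)

  inj′ : Injective _≡_ _≡_ f′
  inj′ {zero}  {zero}  _  = refl
  inj′ {suc i} {suc j} eq = cong suc (inj (suc-injective eq))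

  nonadjacent : ∀ i → lookup r (f i) ≡ false
  nonadjacent i = Equivalence.to Bool.T-not-≡
    (subst T (lookup-map (f i) not r) (proj₂ (∩-sound s (Vec.map not r) (f i) (within i))))

  coclique′ : ∀ i j → adj (r ∷ g) (f′ i) (f′ j) ≡ false
  coclique′ zero    zero    = refl
  coclique′ zero    (suc j) = nonadjacent j
  coclique′ (suc i) zero    = nonadjacent i
  coclique′ (suc i) (suc j) = coclique i j

  within′ : ∀ i → T (lookup (b ∷ s) (f′ i))
  within′ zero    = tb
  within′ (suc i) = proj₁ (∩-sound s (Vec.map not r) (f i) (within i))

containsCoclique : ℕ → Graph n → Bool
containsCoclique k g = hasCoclique k (replicate _ true) g

containsCoclique-sound : ∀ k (g : Graph n) → T (containsCoclique k g) → edgeless k ≼ adj g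
containsCoclique-sound k g t with hasCoclique-sound k (replicate _ true) g t
... | f , inj , coclique , _ = _ , here , f , inj , coclique

-- Induced embeddings and isomorphism

anyIn : Vec Bool n → (Fin n → Bool) → Bool
anyIn []      p = false
anyIn (b ∷ s) p = (b ∧ p zero) ∨ anyIn s (p ∘ suc)

anyIn-sound : ∀ (s : Vec Bool n) p → T (anyIn s p) → ∃ λ v → T (lookup s v) × T (p v)
anyIn-sound (b ∷ s) p t with Equivalence.to (Bool.T-∨ {b ∧ p zero}) t
... | inj₁ t′ = zero , Equivalence.to Bool.T-∧ t′
... | inj₂ t′ with anyIn-sound s (p ∘ suc) t′
...   | v , q = suc v , q

restrict : Graph n → Fin n → Vec Bool k → Vec (Vec Bool n) k → Vec (Vec Bool n) k
restrict g v = zipWith (λ b s → s ∩ link b g v)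

-- Backtracking with forward checking: the i-th set holds the vertices of g that may still
-- represent the i-th vertex of t.
embedsWithin : Vec (Vec Bool n) k → Graph k → Graph n → Bool
embedsWithin []       []      g = true
embedsWithin (s ∷ ss) (r ∷ t) g = anyIn s λ v → embedsWithin (restrict g v r ss) t g

-- Every later image lies in a set already intersected with a `link` of `v`; this gives both its
-- distinctness from `v` and the prescribed adjacency to `v`.
embedsWithin-sound : ∀ (ss : Vec (Vec Bool n) k) t g → T (embedsWithin ss t g) →
  Σ (Fin k → Fin n) λ f → Injective _≡_ _≡_ f × (∀ i j → adj g (f i) (f j) ≡ adj t i j) ×
    (∀ i → T (lookup (lookup ss i) (f i)))
embedsWithin-sound [] [] g _ = (λ ()) , (λ {}) , (λ ()) , (λ ())
embedsWithin-sound {n} {suc k} (s ∷ ss) (r ∷ t) g p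
  with anyIn-sound s (λ v → embedsWithin (restrict g v r ss) t g) p
... | v , v∈s , q with embedsWithin-sound (restrict g v r ss) t g q
...   | f , inj , eq , within = f′ , inj′ , eq′ , within′
  where
  f′ : Fin (suc k) → Fin n
  f′ zero    = v
  f′ (suc i) = f i

  allowed : ∀ i → T (lookup (lookup ss i) (f i)) × T (lookup (link (lookup r i) g v) (f i))
  allowed i = ∩-sound (lookup ss i) (link (lookup r i) g v) (f i)
    (subst (λ s → T (lookup s (f i))) (lookup-zipWith _ i r ss) (within i))

  linked : ∀ i → v ≢ f i × adj g v (f i) ≡ lookup r i
  linked i = link-sound (lookup r i) g v (f i) (proj₂ (allowed i))

  inj′ : Injective _≡_ _≡_ f′
  inj′ {zero}  {zero}  _  = refl
  inj′ {zero}  {suc j} eq = contradiction eq (proj₁ (linked j))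
  inj′ {suc i} {zero}  eq = contradiction (sym eq) (proj₁ (linked i))
  inj′ {suc i} {suc j} eq = cong suc (inj eq)

  eq′ : ∀ i j → adj g (f′ i) (f′ j) ≡ adj (r ∷ t) i j
  eq′ zero    zero    = adj-irrefl g v
  eq′ zero    (suc j) = proj₂ (linked j)
  eq′ (suc i) zero    = trans (adj-sym g (f i) v) (proj₂ (linked i))
  eq′ (suc i) (suc j) = eq i j

  within′ : ∀ i → T (lookup (lookup (s ∷ ss) i) (f′ i))
  within′ zero    = v∈s
  within′ (suc i) = proj₁ (allowed i)

degrees : Graph n → Vec ℕ n
degrees g = tabulate λ v → Vec.count T? (link true g v)

agreements : Vec ℕ m → Vec ℕ n → Vec (Vec Bool n) m
agreements ds es = Vec.map (λ d → Vec.map (d ≡ᵇ_) es) ds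

-- The degrees serve only to prune the search.
isomorphic : Graph n → Graph n → Bool
isomorphic t g = embedsWithin (agreements (degrees t) (degrees g)) t g

-- Both graphs have `n` vertices, so the induced embedding found is an isomorphism.
isomorphic-sound : ∀ (t g : Graph n) → T (isomorphic t g) →
  Σ (Fin n → Fin n) λ f → Injective _≡_ _≡_ f × (∀ i j → adj g (f i) (f j) ≡ adj t i j)
isomorphic-sound t g p
  with embedsWithin-sound (agreements (degrees t) (degrees g)) t g p
... | f , inj , eq , _ = f , inj , eq

-- The certificate

bits : ∀ n → ℕ → Vec Bool n
bits zero    _ = []
bits (suc n) m = (m % 2 ≡ᵇ 1) ∷ bits n (m / 2)

-- Bit j of the i-th mask is the adjacency of the vertices i and i + 1 + j.
fromMasks : Vec ℕ n → Graph n
fromMasks []               = []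
fromMasks {suc n} (m ∷ ms) = bits n m ∷ fromMasks ms

-- The j-th entry of toNext lists sequences that lead to the j-th graph of the next level.
record Node (n : ℕ) : Set where
  constructor node
  field
    masks      : Vec ℕ n
    toCoclique : List ℕ
    toNext     : List (List ℕ)

  graph : Graph n
  graph = fromMasks masks

open Node

nodes : ∀ n → List (Node n)
nodes 0 =
  node [] []
    ((0x0 ∷ []) ∷ []) ∷
  []
nodes 1 =
  node (0 ∷ []) []
    ((0x0 ∷ []) ∷ (0x0 ∷ []) ∷ []) ∷
  []
nodes 2 =
  node (0 ∷ 0 ∷ []) []
    ((0x0 ∷ []) ∷ (0x0 ∷ []) ∷ (0x0 ∷ []) ∷ []) ∷
  node (1 ∷ 0 ∷ []) []
    ([] ∷ (0x0 ∷ []) ∷ (0x1 ∷ []) ∷ []) ∷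
  []
nodes 3 =
  node (0 ∷ 0 ∷ 0 ∷ []) (0x0 ∷ [])
    ((0x0 ∷ []) ∷ (0x0 ∷ []) ∷ (0x0 ∷ []) ∷ []) ∷
  node (0 ∷ 1 ∷ 0 ∷ []) []
    ((0x0 ∷ []) ∷ (0x1 ∷ []) ∷ [] ∷ (0x0 ∷ []) ∷ (0x1 ∷ 0x0 ∷ []) ∷ []) ∷
  node (2 ∷ 1 ∷ 0 ∷ []) []
    ([] ∷ (0x0 ∷ []) ∷ (0x0 ∷ []) ∷ [] ∷ (0x4 ∷ 0x0 ∷ 0x1212 ∷ []) ∷ []) ∷
  []
nodes 4 =
  node (0 ∷ 0 ∷ 1 ∷ 0 ∷ []) (0x1 ∷ [])
    ((0x0 ∷ []) ∷ (0x0 ∷ []) ∷ (0x1 ∷ 0x0 ∷ []) ∷ (0x1 ∷ 0x1242 ∷ []) ∷ []) ∷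
  node (0 ∷ 2 ∷ 1 ∷ 0 ∷ []) (0x0 ∷ [])
    ([] ∷ (0x0 ∷ []) ∷ (0x5 ∷ 0x0 ∷ 0x1232 ∷ []) ∷ (0x5 ∷ []) ∷ (0x5 ∷ 0x35 ∷ 0x1242 ∷ []) ∷ []) ∷
  node (4 ∷ 2 ∷ 1 ∷ 0 ∷ []) (0x0 ∷ [])
    ([] ∷ [] ∷ [] ∷ (0x15 ∷ 0x1212 ∷ []) ∷ (0x1 ∷ 0x21 ∷ 0x1313 ∷ []) ∷ []) ∷
  node (4 ∷ 1 ∷ 0 ∷ 0 ∷ []) []
    ((0x0 ∷ []) ∷ (0x1 ∷ []) ∷ [] ∷ [] ∷ (0x0 ∷ 0x2 ∷ 0x5 ∷ []) ∷ []) ∷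
  node (4 ∷ 3 ∷ 1 ∷ 0 ∷ []) []
    ([] ∷ [] ∷ (0x0 ∷ []) ∷ (0x0 ∷ 0x1235 ∷ []) ∷ (0x1243 ∷ 0x4 ∷ 0x315 ∷ 0x125 ∷ []) ∷
     (0x0 ∷ 0x1 ∷ []) ∷ []) ∷
  []
nodes 5 =
  node (0 ∷ 4 ∷ 1 ∷ 0 ∷ 0 ∷ []) (0x1 ∷ 0x1313 ∷ [])
    ((0x0 ∷ []) ∷ (0x1 ∷ 0x0 ∷ []) ∷ (0x0 ∷ 0x3 ∷ 0x6 ∷ []) ∷ []) ∷
  node (8 ∷ 4 ∷ 1 ∷ 0 ∷ 0 ∷ []) (0x1 ∷ [])
    ([] ∷ (0x6 ∷ 0x0 ∷ 0x1212 ∷ []) ∷ [] ∷ (0x6 ∷ 0x2346 ∷ 0x26 ∷ 0x0 ∷ 0x36 ∷ 0x1261 ∷ []) ∷ []) ∷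
  node (0 ∷ 4 ∷ 3 ∷ 1 ∷ 0 ∷ []) (0x4 ∷ 0x0 ∷ 0x34 ∷ [])
    ([] ∷ (0x0 ∷ []) ∷ (0x1242 ∷ []) ∷ (0x1454 ∷ 0x4613 ∷ 0x6135 ∷ 0x0 ∷ 0x3 ∷ []) ∷
     (0x0 ∷ 0x1 ∷ []) ∷ (0x1 ∷ 0x31 ∷ []) ∷ (0x0 ∷ []) ∷ []) ∷
  node (8 ∷ 7 ∷ 3 ∷ 1 ∷ 0 ∷ []) (0x3 ∷ 0x23 ∷ [])
    ([] ∷ [] ∷ (0x416 ∷ 0x3 ∷ 0x36 ∷ []) ∷ (0x3146 ∷ 0x4136 ∷ 0x1315 ∷ 0x1515 ∷ []) ∷ [] ∷
     (0x161 ∷ 0x1 ∷ 0x62 ∷ []) ∷ []) ∷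
  node (4 ∷ 5 ∷ 2 ∷ 1 ∷ 0 ∷ []) (0x3 ∷ [])
    ([] ∷ [] ∷ (0x1212 ∷ []) ∷ (0x315 ∷ 0x1 ∷ 0x125 ∷ 0x415 ∷ []) ∷ [] ∷
     (0x5 ∷ 0x25 ∷ 0x3435 ∷ []) ∷ (0x1213 ∷ []) ∷ (0x1 ∷ 0x125 ∷ []) ∷ []) ∷
  node (12 ∷ 5 ∷ 1 ∷ 1 ∷ 0 ∷ []) []
    ([] ∷ [] ∷ [] ∷ [] ∷ (0x1212 ∷ []) ∷
     (0x3 ∷ 0x5 ∷ 0x14 ∷ 0x63 ∷ 0x213 ∷ 0x234 ∷ 0x256 ∷ 0x1416 ∷ []) ∷ [] ∷
     (0x156 ∷ 0x15 ∷ 0x5 ∷ 0x1316 ∷ 0x1 ∷ []) ∷ (0x1312 ∷ []) ∷ []) ∷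
  []
nodes 6 =
  node (16 ∷ 4 ∷ 1 ∷ 0 ∷ 0 ∷ 0 ∷ []) (0x1 ∷ 0x21 ∷ 0x31 ∷ 0x1232 ∷ [])
    [] ∷
  node (16 ∷ 1 ∷ 0 ∷ 3 ∷ 1 ∷ 0 ∷ []) (0x51 ∷ 0x1 ∷ 0x235 ∷ [])
    ((0x0 ∷ 0x1 ∷ []) ∷ (0x151 ∷ 0x153 ∷ 0x154 ∷ 0x161 ∷ 0x163 ∷ 0x164 ∷ []) ∷ []) ∷
  node (16 ∷ 4 ∷ 5 ∷ 2 ∷ 1 ∷ 0 ∷ []) (0x41 ∷ 0x1 ∷ [])
    ([] ∷ (0x671 ∷ 0x674 ∷ 0x675 ∷ 0x676 ∷ 0x13 ∷ 0x1272 ∷ []) ∷ (0x1 ∷ 0x31 ∷ []) ∷ []) ∷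
  node (8 ∷ 12 ∷ 5 ∷ 2 ∷ 0 ∷ 0 ∷ []) (0x41 ∷ [])
    ([] ∷ (0x376 ∷ 0x316 ∷ 0x2376 ∷ []) ∷ [] ∷ (0x63 ∷ 0x67 ∷ 0x267 ∷ 0x263 ∷ []) ∷
     (0x1 ∷ 0x124 ∷ 0x412 ∷ 0x4541 ∷ []) ∷ []) ∷
  node (0 ∷ 12 ∷ 5 ∷ 1 ∷ 1 ∷ 0 ∷ []) (0x1 ∷ 0x16 ∷ [])
    ((0x1212 ∷ []) ∷
     (0x1564 ∷ 0x1475 ∷ 0x41 ∷ 0x51 ∷ 0x471 ∷ 0x1262 ∷ 0x1272 ∷ 0x1467 ∷ 0x2136 ∷ []) ∷ [] ∷ [] ∷
     (0x0 ∷ 0x36 ∷ 0x45 ∷ 0x46 ∷ 0x54 ∷ 0x57 ∷ 0x4635 ∷ 0x2473 ∷ []) ∷ (0x1212 ∷ []) ∷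
     (0x1212 ∷ []) ∷ []) ∷
  node (20 ∷ 13 ∷ 6 ∷ 3 ∷ 1 ∷ 0 ∷ []) (0x231 ∷ [])
    ([] ∷ (0x73 ∷ 0x74 ∷ 0x1236 ∷ 0x1562 ∷ []) ∷ (0x21 ∷ 0x65 ∷ 0x167 ∷ []) ∷
     (0x171 ∷ 0x25 ∷ 0x37 ∷ 0x65 ∷ 0x231 ∷ 0x241 ∷ 0x2356 ∷ []) ∷
     (0x1375 ∷ 0x1237 ∷ 0x1353 ∷ 0x1734 ∷ []) ∷ [] ∷ (0x1217 ∷ []) ∷ (0x7 ∷ 0x734 ∷ []) ∷ []) ∷
  node (16 ∷ 4 ∷ 7 ∷ 3 ∷ 0 ∷ 0 ∷ []) (0x41 ∷ [])
    ([] ∷ [] ∷ [] ∷ [] ∷ (0x4 ∷ 0x5 ∷ 0x24 ∷ 0x54 ∷ 0x34 ∷ 0x463 ∷ 0x634 ∷ []) ∷ [] ∷ [] ∷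
     (0x14 ∷ 0x15 ∷ 0x214 ∷ 0x215 ∷ []) ∷ []) ∷
  node (24 ∷ 10 ∷ 7 ∷ 1 ∷ 1 ∷ 0 ∷ []) (0x34 ∷ [])
    ([] ∷ [] ∷ (0x14 ∷ 0x62 ∷ 0x3615 ∷ []) ∷
     (0x6153 ∷ 0x1627 ∷ 0x14 ∷ 0x24 ∷ 0x47 ∷ 0x141 ∷ 0x274 ∷ 0x461 ∷ 0x743 ∷ 0x1423 ∷ 0x3 ∷
       0x1415 ∷ []) ∷
     (0x14 ∷ 0x141 ∷ 0x1272 ∷ 0x1273 ∷ []) ∷ [] ∷ [] ∷
     (0x671 ∷ 0x156 ∷ 0x27 ∷ 0x7 ∷ 0x1264 ∷ 0x1315 ∷ 0x1632 ∷ 0x1676 ∷ []) ∷ []) ∷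
  node (28 ∷ 13 ∷ 5 ∷ 1 ∷ 0 ∷ 0 ∷ []) []
    ([] ∷ [] ∷ [] ∷ [] ∷ [] ∷ (0x1212 ∷ []) ∷ (0x2 ∷ 0x3 ∷ 0x4 ∷ 0x5 ∷ 0x467 ∷ []) ∷
     (0x2 ∷ 0x5 ∷ 0x6 ∷ 0x27 ∷ 0x252 ∷ 0x254 ∷ 0x4 ∷ 0x36 ∷ 0x262 ∷ 0x672 ∷ 0x3 ∷ 0x2745 ∷ []) ∷
       []) ∷
  []
nodes 7 =
  node (1 ∷ 0 ∷ 12 ∷ 5 ∷ 1 ∷ 1 ∷ 0 ∷ []) (0x41 ∷ 0x21 ∷ 0x217 ∷ [])
    ((0x0 ∷ []) ∷ (0x1 ∷ 0x1212 ∷ []) ∷ []) ∷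
  node (48 ∷ 28 ∷ 15 ∷ 7 ∷ 2 ∷ 0 ∷ 0 ∷ []) (0x731 ∷ 0x241 ∷ 0x34 ∷ [])
    ([] ∷ (0x1248 ∷ []) ∷ (0x1 ∷ 0x3 ∷ []) ∷ (0x84 ∷ 0x85 ∷ 0x123 ∷ 0x131 ∷ []) ∷
     (0x13 ∷ 0x1345 ∷ 0x1354 ∷ []) ∷ (0x1414 ∷ []) ∷ []) ∷
  node (48 ∷ 12 ∷ 11 ∷ 7 ∷ 2 ∷ 1 ∷ 0 ∷ []) (0x241 ∷ 0x351 ∷ [])
    ([] ∷ [] ∷ [] ∷ (0x31 ∷ 0x182 ∷ 0x1735 ∷ 0x2631 ∷ 0x1358 ∷ 0x1645 ∷ 0x1715 ∷ 0x2386 ∷ []) ∷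
     (0x271 ∷ 0x7136 ∷ 0x1287 ∷ 0x2167 ∷ 0x2372 ∷ 0x6487 ∷ 0x7361 ∷ []) ∷ [] ∷ (0x1218 ∷ []) ∷
     (0x14 ∷ 0x1363 ∷ []) ∷ []) ∷
  node (48 ∷ 18 ∷ 14 ∷ 5 ∷ 3 ∷ 1 ∷ 0 ∷ []) (0x371 ∷ 0x24 ∷ 0x823 ∷ [])
    ([] ∷ [] ∷ [] ∷ (0x12 ∷ 0x364 ∷ 0x1375 ∷ 0x1412 ∷ 0x3834 ∷ []) ∷
     (0x86 ∷ 0x285 ∷ 0x2564 ∷ 0x5613 ∷ 0x5618 ∷ []) ∷ [] ∷ [] ∷ [] ∷
     (0x86 ∷ 0x285 ∷ 0x1568 ∷ 0x1274 ∷ 0x1531 ∷ 0x1538 ∷ 0x1671 ∷ 0x2147 ∷ 0x2386 ∷ 0x3567 ∷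
       0x5672 ∷ []) ∷
     (0x1212 ∷ []) ∷ []) ∷
  node (32 ∷ 12 ∷ 5 ∷ 5 ∷ 3 ∷ 1 ∷ 0 ∷ []) (0x1 ∷ 0x46 ∷ 0x245 ∷ [])
    ([] ∷ [] ∷ [] ∷ (0x3 ∷ 0x23 ∷ 0x186 ∷ 0x382 ∷ 0x1245 ∷ 0x2186 ∷ 0x2382 ∷ 0x4125 ∷ []) ∷
     (0x5418 ∷ 0x1512 ∷ 0x8125 ∷ []) ∷ (0x561 ∷ []) ∷ [] ∷ [] ∷
     (0x58 ∷ 0x258 ∷ 0x486 ∷ 0x787 ∷ 0x872 ∷ 0x2486 ∷ 0x3784 ∷ 0x1612 ∷ 0x3651 ∷ []) ∷ []) ∷
  node (0 ∷ 28 ∷ 13 ∷ 5 ∷ 1 ∷ 0 ∷ 0 ∷ []) (0x1 ∷ [])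
    ((0x1212 ∷ []) ∷ (0x3 ∷ 0x4 ∷ 0x5 ∷ 0x6 ∷ 0x578 ∷ []) ∷ [] ∷ [] ∷ [] ∷
     (0x0 ∷ 0x34 ∷ 0x57 ∷ 0x3478 ∷ 0x45 ∷ 0x68 ∷ 0x3568 ∷ 0x36 ∷ []) ∷ []) ∷
  node (49 ∷ 20 ∷ 15 ∷ 7 ∷ 2 ∷ 1 ∷ 0 ∷ []) (0x41 ∷ 0x234 ∷ [])
    ([] ∷ (0x0 ∷ 0x454 ∷ 0x1214 ∷ 0x1246 ∷ []) ∷ [] ∷ [] ∷
     (0x1 ∷ 0x6 ∷ 0x84 ∷ 0x85 ∷ 0x86 ∷ 0x87 ∷ 0x231 ∷ 0x268 ∷ 0x321 ∷ 0x631 ∷ 0x682 ∷ 0x7 ∷ 0x182 ∷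
       0x238 ∷ 0x326 ∷ 0x645 ∷ 0x721 ∷ 0x8127 ∷ 0x8136 ∷ []) ∷
     []) ∷
  node (56 ∷ 26 ∷ 15 ∷ 5 ∷ 2 ∷ 1 ∷ 0 ∷ []) (0x174 ∷ 0x147 ∷ 0x4 ∷ 0x234 ∷ 0x274 ∷ 0x374 ∷ [])
    ([] ∷ [] ∷ [] ∷ [] ∷
     (0x2 ∷ 0x4 ∷ 0x234 ∷ 0x8572 ∷ 0x53624 ∷ 0x1245 ∷ 0x1246 ∷ 0x1547 ∷ 0x5627 ∷ 0x5735 ∷ 0x5853 ∷
       0x5856 ∷ 0x6865 ∷ []) ∷
     (0x1235 ∷ []) ∷ [] ∷ (0x0 ∷ 0x17 ∷ 0x573 ∷ []) ∷
     (0x2 ∷ 0x3 ∷ 0x257 ∷ 0x358 ∷ 0x785 ∷ 0x786 ∷ 0x7148 ∷ 0x1246 ∷ 0x1254 ∷ 0x1268 ∷ 0x1345 ∷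
       0x1358 ∷ 0x1364 ∷ 0x2145 ∷ 0x2376 ∷ 0x3146 ∷ 0x3562 ∷ []) ∷
     []) ∷
  []
nodes 8 =
  node (1 ∷ 0 ∷ 28 ∷ 13 ∷ 5 ∷ 1 ∷ 0 ∷ 0 ∷ []) (0x1 ∷ 0x21 ∷ [])
    [] ∷
  node (32 ∷ 41 ∷ 18 ∷ 15 ∷ 6 ∷ 3 ∷ 1 ∷ 0 ∷ []) (0x51 ∷ 0x251 ∷ 0x345 ∷ 0x2345 ∷ [])
    ((0x8 ∷ 0x3 ∷ 0x1298 ∷ []) ∷ []) ∷
  node (80 ∷ 20 ∷ 29 ∷ 13 ∷ 5 ∷ 3 ∷ 1 ∷ 0 ∷ []) (0x41 ∷ 0x381 ∷ 0x129 ∷ 0x651 ∷ [])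
    ((0x0 ∷ 0x5 ∷ []) ∷ []) ∷
  node (80 ∷ 20 ∷ 25 ∷ 11 ∷ 5 ∷ 1 ∷ 1 ∷ 0 ∷ []) (0x721 ∷ 0x127 ∷ 0x718 ∷ 0x19 ∷ 0x1653 ∷ [])
    ([] ∷ (0x1256 ∷ 0x1952 ∷ 0x2328 ∷ 0x2789 ∷ 0x2797 ∷ 0x3792 ∷ 0x5978 ∷ 0x6375 ∷ []) ∷ []) ∷
  node (112 ∷ 60 ∷ 27 ∷ 7 ∷ 4 ∷ 2 ∷ 0 ∷ 0 ∷ []) (0x7251 ∷ 0x361 ∷ 0x16 ∷ 0x283 ∷ 0x83 ∷ 0x842 ∷ [])
    ([] ∷ (0x4176 ∷ 0x5 ∷ 0x2813 ∷ 0x3594 ∷ 0x4723 ∷ 0x5734 ∷ 0x12425 ∷ []) ∷ []) ∷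
  node (64 ∷ 26 ∷ 11 ∷ 2 ∷ 7 ∷ 2 ∷ 1 ∷ 0 ∷ []) (0x3571 ∷ 0x61 ∷ 0x419 ∷ 0x371 ∷ 0x735 ∷ 0x2735 ∷
       0x23546 ∷ [])
    [] ∷
  node (112 ∷ 52 ∷ 7 ∷ 15 ∷ 5 ∷ 1 ∷ 1 ∷ 0 ∷ []) (0x261 ∷ 0x761 ∷ 0x412 ∷ 0x129 ∷ [])
    [] ∷
  node (120 ∷ 58 ∷ 27 ∷ 10 ∷ 3 ∷ 2 ∷ 1 ∷ 0 ∷ []) (0x3621 ∷ 0x2351 ∷ 0x671 ∷ 0x3 ∷ 0x389 ∷ 0x726 ∷
       [])
    [] ∷
  node (76 ∷ 57 ∷ 11 ∷ 10 ∷ 3 ∷ 3 ∷ 1 ∷ 0 ∷ []) (0x5241 ∷ 0x2731 ∷ 0x571 ∷ 0x45 ∷ 0x58 ∷ 0x731 ∷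
       0x132 ∷ 0x314 ∷ 0x641 ∷ [])
    ([] ∷ (0x2514 ∷ 0x1272 ∷ 0x1286 ∷ 0x1438 ∷ 0x2597 ∷ []) ∷ []) ∷
  node (112 ∷ 52 ∷ 21 ∷ 9 ∷ 7 ∷ 3 ∷ 1 ∷ 0 ∷ []) (0x631 ∷ 0x581 ∷ 0x924 ∷ 0x496 ∷ 0x2314 ∷ 0x2135 ∷
       [])
    [] ∷
  []
nodes 9 =
  node (192 ∷ 25 ∷ 10 ∷ 23 ∷ 13 ∷ 6 ∷ 3 ∷ 1 ∷ 0 ∷ []) (0xa1 ∷ 0x15 ∷ 0x21 ∷ 0x126 ∷ [])
    ((0x0 ∷ []) ∷ []) ∷
  node (104 ∷ 74 ∷ 60 ∷ 28 ∷ 13 ∷ 5 ∷ 3 ∷ 1 ∷ 0 ∷ []) (0x41 ∷ 0x149 ∷ 0x1213 ∷ [])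
    [] ∷
  []
nodes 10 =
  node (193 ∷ 80 ∷ 69 ∷ 33 ∷ 30 ∷ 15 ∷ 5 ∷ 2 ∷ 1 ∷ 0 ∷ []) (0x41 ∷ 0x1 ∷ [])
    [] ∷
  []
nodes _ = []

reachesNext : List (Node (suc n)) → List (List ℕ) → Graph (suc n) → Bool
reachesNext (ν ∷ νs) (ws ∷ wss) g =
  any (λ w → isomorphic (graph ν) (run w g)) ws ∨ reachesNext νs wss g
reachesNext _        _          g = false

-- The new vertex comes first: in the sequences the digit 1 denotes it, and the digit d + 2 denotes
-- the vertex d of `graph ν`.
extensionCovered : Node n → Vec Bool n → Bool
extensionCovered {n} ν x =
  any (λ w → containsCoclique 4 (run w (x ∷ graph ν))) (toCoclique ν)
    ∨ reachesNext (nodes (suc n)) (toNext ν) (x ∷ graph ν)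

every : ∀ n → (Vec Bool n → Bool) → Bool
every zero    p = p []
every (suc n) p = every n (λ x → p (true ∷ x)) ∧ every n (λ x → p (false ∷ x))

every-sound : ∀ n p → T (every n p) → ∀ x → T (p x)
every-sound zero    p t []          = t
every-sound (suc n) p t (true ∷ x)  =
  every-sound n _ (proj₁ (Equivalence.to (Bool.T-∧ {every n (λ x → p (true ∷ x))}) t)) x
every-sound (suc n) p t (false ∷ x) =
  every-sound n _ (proj₂ (Equivalence.to (Bool.T-∧ {every n (λ x → p (true ∷ x))}) t)) x

covered : ℕ → Bool
covered n = all (λ ν → every n (extensionCovered ν)) (nodes n)

-- This is the finite computation behind the upper bound: type checking evaluates the test for every
-- listed graph on n < 11 vertices and all 2^n neighbourhoods of a new vertex.
covered-<11 : ∀ {n} → n < 11 → T (covered n)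
covered-<11 n<11 = subst (T ∘ covered) (toℕ-fromℕ< n<11)
  (toWitness {a? = all? λ (i : Fin 11) → T? (covered (toℕ i))} _ (fromℕ< n<11))

-- Soundness of the certificate and the upper bound

ContainsNode : ∀ n → Adj N → Set
ContainsNode n G = Any (λ ν → adj (graph ν) ≼ G) (nodes n)

reachesNext-sound : ∀ (νs : List (Node (suc n))) wss g → T (reachesNext νs wss g) →
  Any (λ ν → adj (graph ν) ≼ adj g) νs
reachesNext-sound (ν ∷ νs) (ws ∷ wss) g t
  with Equivalence.to (Bool.T-∨ {any (λ w → isomorphic (graph ν) (run w g)) ws}) t
... | inj₂ t′ = there (reachesNext-sound νs wss g t′)
... | inj₁ t′ with satisfied (any⁻ _ ws t′)
...   | w , p = here (≼-trans (_ , here , isomorphic-sound (graph ν) (run w g) p) (run-≼ w g))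

extensionCovered-sound : ∀ (ν : Node n) x → T (extensionCovered ν x) →
  edgeless 4 ≼ adj (x ∷ graph ν) ⊎ ContainsNode (suc n) (adj (x ∷ graph ν))
extensionCovered-sound {n} ν x t with Equivalence.to
  (Bool.T-∨ {any (λ w → containsCoclique 4 (run w (x ∷ graph ν))) (toCoclique ν)}) t
... | inj₂ t′ = inj₂ (reachesNext-sound (nodes (suc n)) (toNext ν) (x ∷ graph ν) t′)
... | inj₁ t′ with satisfied (any⁻ _ (toCoclique ν) t′)
...   | w , p = inj₁ (≼-trans (containsCoclique-sound 4 (run w g) p) (run-≼ w g))
  where g = x ∷ graph ν

-- Induction on `n`, starting from the empty graph. A listed graph found in `G` grows by one vertex
-- inside `G`, and the certificate resolves every such extension into `E₄` or a graph of the next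
-- list.
coclique-or-node : {G : Adj N} → IsSimple G → n ≤ 11 → n ≤ N → edgeless 4 ≼ G ⊎ ContainsNode n G
coclique-or-node {n = zero} simple _ _ =
  inj₂ (here (_ , here , (λ ()) , (λ {}) , (λ ())))
coclique-or-node {n = suc n} {G} simple n<11 n<N
  with coclique-or-node {n = n} simple (ℕ.<⇒≤ n<11) (ℕ.<⇒≤ n<N)
... | inj₁ e = inj₁ e
... | inj₂ a = extend (Any.lookup a) (All.lookupAny (all⁺ _ (nodes n) (covered-<11 n<11)) a)
  where
  extend : ∀ ν → T (every n (extensionCovered ν)) × adj (graph ν) ≼ G →
    edgeless 4 ≼ G ⊎ ContainsNode (suc n) G
  extend ν (c , ν≼G) with extension (graph ν) simple n<N ν≼G
  ... | x , x≼G with extensionCovered-sound ν x (every-sound n _ c x)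
  ...   | inj₁ e = inj₁ (≼-trans e x≼G)
  ...   | inj₂ a = inj₂ (Any.map (λ μ≼x → ≼-trans μ≼x x≼G) a)

-- The list `nodes 11` is empty, so the second alternative is uninhabited and its case disappears.
containsE₄ : AllContainEk 4 11
containsE₄ G simple with coclique-or-node {n = 11} simple ℕ.≤-refl ℕ.≤-refl
... | inj₁ e = e

-- The lower bound

exceptional : Graph 10
exceptional = fromMasks (508 ∷ 253 ∷ 125 ∷ 62 ∷ 31 ∷ 12 ∷ 5 ∷ 1 ∷ 0 ∷ 0 ∷ [])

-- Representatives up to isomorphism. The entry whose masks begin with 193 is the graph listed in
-- `nodes 10`.
orbit : List (Graph 10)
orbit = exceptional ∷ map fromMasks
  ( (385 ∷ 160 ∷ 124 ∷ 61 ∷ 29 ∷ 14 ∷ 7 ∷ 2 ∷ 1 ∷ 0 ∷ [])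
  ∷ (385 ∷ 160 ∷ 124 ∷ 61 ∷ 29 ∷ 14 ∷ 7 ∷ 1 ∷ 0 ∷ 0 ∷ [])
  ∷ (324 ∷ 81 ∷ 36 ∷ 33 ∷ 15 ∷ 11 ∷ 5 ∷ 1 ∷ 1 ∷ 0 ∷ [])
  ∷ (193 ∷ 80 ∷ 69 ∷ 33 ∷ 30 ∷ 15 ∷ 5 ∷ 2 ∷ 1 ∷ 0 ∷ [])
  ∷ (324 ∷ 81 ∷ 36 ∷ 33 ∷ 27 ∷ 14 ∷ 7 ∷ 3 ∷ 1 ∷ 0 ∷ [])
  ∷ [])

-- Checked by evaluation: six graphs with ten local complementations each.
orbit-closed : All (λ g → ∀ v → Any (λ h → T (isomorphic (localComplement g v) h)) orbit) orbit
orbit-closed = toWitness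
  {a? = All.all? (λ g → all? λ v →
    Any.any? (λ h → T? (isomorphic (localComplement g v) h)) orbit) orbit} _

Separated : Graph n → Fin n → Fin n → Set
Separated g a b = a ≢ b × adj g a b ≡ false

separated? : ∀ (g : Graph n) a b → Dec (Separated g a b)
separated? g a b = ¬? (a ≟ b) ×-dec (adj g a b Bool.≟ false)

-- The lower bound requires a proof of absence, whereas `containsCoclique-sound` only interprets
-- success. Each hypothesis stands right after the vertices it concerns, so that the decision
-- procedure abandons a branch at the first adjacent or repeated pair.
CocliqueFree : Graph n → Set
CocliqueFree g = ∀ a b → Separated g a b → ∀ c → Separated g a c → Separated g b c →
  ∀ d → Separated g a d → Separated g b d → ¬ Separated g c d

cocliqueFree? : (g : Graph n) → Dec (CocliqueFree g)
cocliqueFree? g = all? λ a → all? λ b → separated? g a b →-dec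
  (all? λ c → separated? g a c →-dec (separated? g b c →-dec
  (all? λ d → separated? g a d →-dec (separated? g b d →-dec ¬? (separated? g c d)))))

orbit-cocliqueFree : All CocliqueFree orbit
orbit-cocliqueFree = toWitness {a? = All.all? cocliqueFree? orbit} _

EmbedsInto : Adj n → Graph n → Set
EmbedsInto {n} H g =
  Σ (Fin n → Fin n) λ f → Injective _≡_ _≡_ f × (∀ i j → adj g (f i) (f j) ≡ H i j)

-- Induction on the sequence: an isomorphism `f` from `H` to a listed `g` carries local
-- complementation at `v` to local complementation at `f v`, and `orbit-closed` returns the result
-- to the list.
reach-in-orbit : ∀ {H} → LCReach (adj exceptional) H → Any (EmbedsInto H) orbit
reach-in-orbit here = here (id , id , λ _ _ → refl)
reach-in-orbit (step {H} p v) =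
  move (Any.lookup embedded) (All.lookupAny orbit-closed embedded)
  where
  embedded = reach-in-orbit p

  move : ∀ g → (∀ u → Any (λ h → T (isomorphic (localComplement g u) h)) orbit) × EmbedsInto H g →
    Any (EmbedsInto (lc H v)) orbit
  move g (closed , f , inj , eq) = Any.map compose (closed (f v))
    where
    compose : ∀ {h} → T (isomorphic (localComplement g (f v)) h) → EmbedsInto (lc H v) h
    compose {h} t with isomorphic-sound (localComplement g (f v)) h t
    ... | f′ , inj′ , eq′ = f′ ∘ f , inj ∘ inj′ , λ i j →
      trans (eq′ (f i) (f j)) (trans (adj-localComplement g (f v) (f i) (f j))
        (lc-restrict {H = adj g} {R = H} inj eq v i j))

exceptional-lacksE₄ : ¬ HasEdgelessVM 4 (adj exceptional)
exceptional-lacksE₄ (H , p , f , inj , coclique) =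
  refute (Any.lookup embedded) (All.lookupAny orbit-cocliqueFree embedded)
  where
  embedded = reach-in-orbit p

  refute : ∀ g → ¬ (CocliqueFree g × EmbedsInto H g)
  refute g (free , f′ , inj′ , eq) =
    -- The independent set of `H` is carried into the listed graph `g`, where its six pairs are
    -- supplied in the order demanded by `CocliqueFree`.
    free (h 0F) (h 1F) (sep λ ()) (h 2F) (sep λ ()) (sep λ ())
      (h 3F) (sep λ ()) (sep λ ()) (sep λ ())
    where
    h : Fin 4 → Fin 10
    h = f′ ∘ f

    sep : ∀ {i j} → i ≢ j → Separated g (h i) (h j)
    sep {i} {j} i≢j = i≢j ∘ inj ∘ inj′ , trans (eq (f i) (f j)) (coclique i j)

-- The subgraph induced on the first `m` vertices of `G` already has `E_k` as a vertex-minor, and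
-- transitivity passes it on to `G`.
AllContainEk-mono : m ≤ n → AllContainEk k m → AllContainEk k n
AllContainEk-mono m≤n containing G (sym-G , irr-G) =
  ≼-trans (containing (λ i j → G (ι i) (ι j)) ((λ i j → sym-G (ι i) (ι j)) , irr-G ∘ ι))
    (G , here , ι , inject≤-injective m≤n m≤n _ _ , λ _ _ → refl)
  where
  ι = λ i → inject≤ i m≤n

theorem4p3 : RvmIs 4 11
theorem4p3 = containsE₄ , λ m m<11 containing →
  -- From `m < 11` follows `m ≤ 10`, so a smaller bound would by monotonicity apply to the
  -- exceptional graph on ten vertices.
  exceptional-lacksE₄
    (AllContainEk-mono (s≤s⁻¹ m<11) containing (adj exceptional) (adj-simple exceptional))
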